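{- The majority function has exponential algebraic thickness: $\mathcal{T}(MAJ_n)\geq 2^{\Omega(n^{1/6})}$. That is, there is a constant $c>0$ such that for all sufficiently large $n$, $\mathcal{T}(MAJ_n)\geq 2^{c\,n^{1/6}}$.
   Context: $MAJ_n\colon\mathbb{F}_2^n\to\mathbb{F}_2$ is $1$ if and only if at least half of its $n$ inputs are $1$. Every $f\colon\mathbb{F}_2^n\to\mathbb{F}_2$ is uniquely a multilinear polynomial over $\mathbb{F}_2$ (its algebraic normal form): $f(x)=\sum_{S\subseteq[n]}c_S\prod_{j\in S}x_j$ with $c_S\in\{0,1\}$ and $[n]=\{1,\dots,n\}$. The sparsity $\|f\|$ is the number of $S$ with $c_S=1$. The algebraic thickness is $\mathcal{T}(f)=\min_{A\in\mathcal{A}_n}\|f\circ A\|$, where $\mathcal{A}_n$ is the set of affine bijections $\mathbb{F}_2^n\to\mathbb{F}_2^n$. -}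

module Defs where

open import Data.Bool.Base using (Bool; true; false; _∧_; _xor_; if_then_else_)
open import Data.Bool.Properties as Bool
  using (xor-same; xor-assoc; xor-identityʳ; ∧-zeroʳ; ∧-identityʳ)
open import Data.Fin.Subset using (Subset; outside; inside)
open import Data.List.Base
  using (List; []; _∷_; _++_; map; foldr; filter; length; cartesianProductWith)
open import Data.List.Extrema.Nat using (min; min≤xs; argmin-sel)
open import Data.List.Membership.Propositional using (_∈_; lose)
open import Data.List.Membership.Propositional.Properties
  using (∈-cartesianProductWith⁺; ∈-filter⁺; ∈-filter⁻; ∈-map⁺; ∈-map⁻)
open import Data.List.Properties using (map-∘; map-cong; ++-identityʳ)
open import Data.List.Relation.Unary.All as All using ([]; _∷_; all?)
open import Data.List.Relation.Unary.Any using (here; there; any?; satisfied)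
open import Data.List.Relation.Unary.AllPairs using ([]; _∷_)
open import Data.List.Relation.Unary.Unique.Propositional using (Unique)
import Data.List.Relation.Unary.Unique.Propositional.Properties as Unique
open import Data.Nat.Base using (ℕ; zero; suc; _*_; _^_; _≤_; NonZero)
open import Data.Nat.Properties using (_≤?_)
open import Data.Product.Base using (∃; _×_; _,_; proj₁; proj₂)
open import Data.Sum.Base using (inj₁; inj₂)
open import Data.Vec.Base as Vec using (Vec; []; _∷_; zipWith; replicate; foldr′; count)
open import Data.Vec.Properties using (≡-dec; ∷-injective) renaming (map-∘ to mapᵥ-∘)
open import Function.Base using (_∘_; id)
open import Function.Definitions using (Injective; Surjective; Bijective)
open import Relation.Binary.PropositionalEquality
  using (_≡_; _≗_; refl; sym; trans; cong; cong₂; module ≡-Reasoning)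
open import Relation.Nullary.Decidable using (Dec; does; map′; _×-dec_; _→-dec_)

-- The field with two elements: addition is _xor_, multiplication is _∧_.
𝔽₂ : Set
𝔽₂ = Bool

𝔽₂^ : ℕ → Set
𝔽₂^ n = Vec 𝔽₂ n

BooleanFunction : ℕ → Set
BooleanFunction n = 𝔽₂^ n → 𝔽₂

_≟ᵥ_ : ∀ {n} (x y : 𝔽₂^ n) → Dec (x ≡ y)
_≟ᵥ_ = ≡-dec Bool._≟_

weight : ∀ {n} → 𝔽₂^ n → ℕ
weight = count (Bool._≟ true)

MAJ : ∀ n → BooleanFunction n
MAJ n x = does (n ≤? 2 * weight x)

∑ : {A : Set} → List A → (A → 𝔽₂) → 𝔽₂
∑ xs t = foldr _xor_ false (map t xs)

vectors : {A : Set} → List A → ∀ n → List (Vec A n)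
vectors xs zero    = [] ∷ []
vectors xs (suc n) = cartesianProductWith _∷_ xs (vectors xs n)

∈-vectors : {A : Set} {xs : List A} → (∀ a → a ∈ xs) → ∀ {n} (v : Vec A n) → v ∈ vectors xs n
∈-vectors h []      = here refl
∈-vectors h (a ∷ v) = ∈-cartesianProductWith⁺ _∷_ (h a) (∈-vectors h v)

vectors-unique : {A : Set} {xs : List A} → Unique xs → ∀ n → Unique (vectors xs n)
vectors-unique u zero    = [] ∷ []
vectors-unique u (suc n) = Unique.cartesianProductWith⁺ _∷_ ∷-injective u (vectors-unique u n)

points : ∀ n → List (𝔽₂^ n)
points = vectors (false ∷ true ∷ [])

∈-points : ∀ {n} (x : 𝔽₂^ n) → x ∈ points n
∈-points = ∈-vectors λ { false → here refl ; true → there (here refl) }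

points-unique : ∀ n → Unique (points n)
points-unique = vectors-unique (((λ ()) ∷ []) ∷ [] ∷ [])

-- `Subset n` unfolds to `Vec Bool n`, so `points` also lists all subsets of [n].
subsets : ∀ n → List (Subset n)
subsets = points

monomial : ∀ {n} → Subset n → 𝔽₂^ n → 𝔽₂
monomial S x = foldr′ _∧_ true (zipWith (λ j∈S xⱼ → if j∈S then xⱼ else true) S x)

MultilinearPolynomial : ℕ → Set
MultilinearPolynomial n = Subset n → 𝔽₂

eval : ∀ {n} → MultilinearPolynomial n → BooleanFunction n
eval {n} c x = ∑ (subsets n) λ S → c S ∧ monomial S x

-- The coefficients of f, from f(x₁,x′) = f(0,x′) + x₁ (f(0,x′) + f(1,x′)).
anf : ∀ {n} → BooleanFunction n → MultilinearPolynomial n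
anf f []            = f []
anf f (outside ∷ S) = anf (λ x → f (false ∷ x)) S
anf f (inside  ∷ S) = anf (λ x → f (false ∷ x) xor f (true ∷ x)) S

∑-cong : {A : Set} {s t : A → 𝔽₂} (xs : List A) → s ≗ t → ∑ xs s ≡ ∑ xs t
∑-cong xs s≗t = cong (foldr _xor_ false) (map-cong s≗t xs)

∑-map : {A B : Set} (g : A → B) (t : B → 𝔽₂) (xs : List A) → ∑ (map g xs) t ≡ ∑ xs (t ∘ g)
∑-map g t xs = cong (foldr _xor_ false) (sym (map-∘ xs))

∑-++ : {A : Set} (t : A → 𝔽₂) (xs ys : List A) → ∑ (xs ++ ys) t ≡ ∑ xs t xor ∑ ys t
∑-++ t []       ys = refl
∑-++ t (x ∷ xs) ys = trans (cong (t x xor_) (∑-++ t xs ys)) (sym (xor-assoc (t x) _ _))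

eval-∷ : ∀ {n} (c : MultilinearPolynomial (suc n)) x₁ (x : 𝔽₂^ n) →
         eval c (x₁ ∷ x) ≡ eval (c ∘ (outside ∷_)) x xor (x₁ ∧ eval (c ∘ (inside ∷_)) x)
eval-∷ {n} c x₁ x = begin
  ∑ (map (false ∷_) ps ++ (map (true ∷_) ps ++ [])) t     ≡⟨ ∑-++ t (map (false ∷_) ps) _ ⟩
  ∑ (map (false ∷_) ps) t xor ∑ (map (true ∷_) ps ++ []) t
    ≡⟨ cong (λ l → ∑ (map (false ∷_) ps) t xor ∑ l t) (++-identityʳ (map (true ∷_) ps)) ⟩
  ∑ (map (false ∷_) ps) t xor ∑ (map (true ∷_) ps) t
    ≡⟨ cong₂ _xor_ (∑-map (false ∷_) t ps) (∑-map (true ∷_) t ps) ⟩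
  ∑ ps (t ∘ (false ∷_)) xor ∑ ps (t ∘ (true ∷_))
    ≡⟨ cong (∑ ps (t ∘ (false ∷_)) xor_) (factor x₁) ⟩
  eval (c ∘ (outside ∷_)) x xor (x₁ ∧ eval (c ∘ (inside ∷_)) x) ∎
  where
  open ≡-Reasoning
  ps = points n
  t  = λ S → c S ∧ monomial S (x₁ ∷ x)

  ∑-false : (xs : List (Subset n)) → ∑ xs (λ S → c (true ∷ S) ∧ false) ≡ false
  ∑-false []       = refl
  ∑-false (S ∷ xs) = cong₂ _xor_ (∧-zeroʳ (c (true ∷ S))) (∑-false xs)

  factor : ∀ b → ∑ ps (λ S → c (true ∷ S) ∧ (b ∧ monomial S x)) ≡ b ∧ eval (c ∘ (inside ∷_)) x
  factor true  = refl
  factor false = ∑-false ps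

xor-cancelˡ : ∀ a b → a xor (a xor b) ≡ b
xor-cancelˡ a b = trans (sym (xor-assoc a a b)) (cong (_xor b) (xor-same a))

anf-correct : ∀ {n} (f : BooleanFunction n) → eval (anf f) ≗ f
anf-correct {zero}  f [] = trans (xor-identityʳ _) (∧-identityʳ _)
anf-correct {suc n} f (false ∷ x) = trans (eval-∷ (anf f) false x)
  (trans (xor-identityʳ _) (anf-correct (λ x → f (false ∷ x)) x))
anf-correct {suc n} f (true ∷ x) = trans (eval-∷ (anf f) true x)
  (trans (cong₂ _xor_ (anf-correct (λ x → f (false ∷ x)) x)
                      (anf-correct (λ x → f (false ∷ x) xor f (true ∷ x)) x))
         (xor-cancelˡ (f (false ∷ x)) (f (true ∷ x))))

anf-unique : ∀ {n} (f : BooleanFunction n) (c : MultilinearPolynomial n) → eval c ≗ f → c ≗ anf f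
anf-unique {zero} f c h [] = trans (sym (trans (xor-identityʳ _) (∧-identityʳ _))) (h [])
anf-unique {suc n} f c h (false ∷ S) = anf-unique _ (c ∘ (false ∷_)) lem S
  where
  lem : eval (c ∘ (false ∷_)) ≗ (λ x → f (false ∷ x))
  lem x = trans (sym (trans (eval-∷ c false x) (xor-identityʳ _))) (h (false ∷ x))
anf-unique {suc n} f c h (true ∷ S) = anf-unique _ (c ∘ (true ∷_)) lem S
  where
  e₀ = λ x → eval (c ∘ (false ∷_)) x
  e₁ = λ x → eval (c ∘ (true ∷_)) x

  lem : e₁ ≗ (λ x → f (false ∷ x) xor f (true ∷ x))
  lem x = trans (sym (xor-cancelˡ (e₀ x) (e₁ x)))
    (cong₂ _xor_ (trans (sym (trans (eval-∷ c false x) (xor-identityʳ (e₀ x)))) (h (false ∷ x)))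
                 (trans (sym (eval-∷ c true x)) (h (true ∷ x))))

sparsity : ∀ {n} → MultilinearPolynomial n → ℕ
sparsity {n} c = length (filter (λ S → c S Bool.≟ true) (subsets n))

‖_‖ : ∀ {n} → BooleanFunction n → ℕ
‖ f ‖ = sparsity (anf f)

infixl 6 _⊕_
_⊕_ : ∀ {n} → 𝔽₂^ n → 𝔽₂^ n → 𝔽₂^ n
_⊕_ = zipWith _xor_

dot : ∀ {n} → 𝔽₂^ n → 𝔽₂^ n → 𝔽₂
dot u v = foldr′ _xor_ false (zipWith _∧_ u v)

-- A square matrix, as the vector of its rows.
Matrix : ℕ → Set
Matrix n = Vec (𝔽₂^ n) n

infixr 7 _·_
_·_ : ∀ {n} → Matrix n → 𝔽₂^ n → 𝔽₂^ n
M · x = Vec.map (λ row → dot row x) M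

record AffineMap (n : ℕ) : Set where
  constructor affine
  field
    matrix : Matrix n
    offset : 𝔽₂^ n

  ⟦_⟧ : 𝔽₂^ n → 𝔽₂^ n
  ⟦_⟧ x = matrix · x ⊕ offset

open AffineMap public

IsBijection : ∀ {n} → AffineMap n → Set
IsBijection A = Bijective _≡_ _≡_ ⟦ A ⟧

∀? : ∀ {n} {P : 𝔽₂^ n → Set} → (∀ x → Dec (P x)) → Dec (∀ x → P x)
∀? {n} P? = map′ (λ ps x → All.lookup ps (∈-points x)) (λ p → All.tabulate λ {x} _ → p x)
                 (all? P? (points n))

∃? : ∀ {n} {P : 𝔽₂^ n → Set} → (∀ x → Dec (P x)) → Dec (∃ P)
∃? {n} P? = map′ satisfied (λ (x , p) → lose (∈-points x) p) (any? P? (points n))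

injective? : ∀ {n} (g : 𝔽₂^ n → 𝔽₂^ n) → Dec (Injective _≡_ _≡_ g)
injective? g = map′ (λ h {x} {y} → h x y) (λ h x y → h {x} {y})
  (∀? λ x → ∀? λ y → (g x ≟ᵥ g y) →-dec (x ≟ᵥ y))

surjective? : ∀ {n} (g : 𝔽₂^ n → 𝔽₂^ n) → Dec (Surjective _≡_ _≡_ g)
surjective? g = map′ (λ h y → proj₁ (h y) , λ { refl → proj₂ (h y) })
                     (λ h y → proj₁ (h y) , proj₂ (h y) refl)
  (∀? λ y → ∃? λ x → g x ≟ᵥ y)

isBijection? : ∀ {n} (A : AffineMap n) → Dec (IsBijection A)
isBijection? A = injective? ⟦ A ⟧ ×-dec surjective? ⟦ A ⟧

affineMaps : ∀ n → List (AffineMap n)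
affineMaps n = cartesianProductWith affine (vectors (points n) n) (points n)

𝒜 : ∀ n → List (AffineMap n)
𝒜 n = filter isBijection? (affineMaps n)

∈-𝒜 : ∀ {n} (A : AffineMap n) → IsBijection A → A ∈ 𝒜 n
∈-𝒜 (affine M b) =
  ∈-filter⁺ isBijection? (∈-cartesianProductWith⁺ affine (∈-vectors ∈-points M) (∈-points b))

-- The default value ‖ f ‖ is the one at the identity of 𝒜 n, so this is a minimum over 𝒜 n;
-- see `𝒯-attained`.
𝒯 : ∀ {n} → BooleanFunction n → ℕ
𝒯 {n} f = min ‖ f ‖ (map (λ A → ‖ f ∘ ⟦ A ⟧ ‖) (𝒜 n))

𝒯-lower : ∀ {n} (f : BooleanFunction n) (A : AffineMap n) → IsBijection A → 𝒯 f ≤ ‖ f ∘ ⟦ A ⟧ ‖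
𝒯-lower f A bij = All.lookup (min≤xs ‖ f ‖ _) (∈-map⁺ (λ A → ‖ f ∘ ⟦ A ⟧ ‖) (∈-𝒜 A bij))

zeros : ∀ {n} → 𝔽₂^ n
zeros = replicate _ false

identityMatrix : ∀ n → Matrix n
identityMatrix zero    = []
identityMatrix (suc n) = (true ∷ zeros) ∷ Vec.map (false ∷_) (identityMatrix n)

dot-zeros : ∀ {n} (x : 𝔽₂^ n) → dot zeros x ≡ false
dot-zeros []      = refl
dot-zeros (_ ∷ x) = dot-zeros x

⊕-zeros : ∀ {n} (x : 𝔽₂^ n) → x ⊕ zeros ≡ x
⊕-zeros []       = refl
⊕-zeros (x₁ ∷ x) = cong₂ _∷_ (xor-identityʳ x₁) (⊕-zeros x)

identityMatrix-· : ∀ {n} (x : 𝔽₂^ n) → identityMatrix n · x ≡ x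
identityMatrix-· []       = refl
identityMatrix-· (x₁ ∷ x) = cong₂ _∷_
  (trans (cong (x₁ xor_) (dot-zeros x)) (xor-identityʳ x₁))
  (trans (sym (mapᵥ-∘ _ _ (identityMatrix _))) (identityMatrix-· x))

identityMap : ∀ n → AffineMap n
identityMap n = affine (identityMatrix n) zeros

identityMap-id : ∀ {n} (x : 𝔽₂^ n) → ⟦ identityMap n ⟧ x ≡ x
identityMap-id x = trans (⊕-zeros _) (identityMatrix-· x)

identityMap-bijection : ∀ n → IsBijection (identityMap n)
identityMap-bijection n =
  (λ {x} {y} e → trans (sym (identityMap-id x)) (trans e (identityMap-id y))) ,
  (λ y → y , λ { refl → identityMap-id y })

anf-cong : ∀ {n} {f g : BooleanFunction n} → f ≗ g → anf f ≗ anf g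
anf-cong h []          = h []
anf-cong h (false ∷ S) = anf-cong (λ x → h (false ∷ x)) S
anf-cong h (true  ∷ S) = anf-cong (λ x → cong₂ _xor_ (h (false ∷ x)) (h (true ∷ x))) S

sparsity-cong : ∀ {n} {c d : MultilinearPolynomial n} → c ≗ d → sparsity c ≡ sparsity d
sparsity-cong {n} {c} {d} h = go (subsets n)
  where
  go : ∀ xs → length (filter (λ S → c S Bool.≟ true) xs) ≡ length (filter (λ S → d S Bool.≟ true) xs)
  go []       = refl
  go (S ∷ xs) with c S | d S | h S
  ... | true  | _ | refl = cong suc (go xs)
  ... | false | _ | refl = go xs

‖‖-cong : ∀ {n} {f g : BooleanFunction n} → f ≗ g → ‖ f ‖ ≡ ‖ g ‖
‖‖-cong h = sparsity-cong (anf-cong h)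

𝒯-attained : ∀ {n} (f : BooleanFunction n) → ∃ λ A → IsBijection A × 𝒯 f ≡ ‖ f ∘ ⟦ A ⟧ ‖
𝒯-attained {n} f with argmin-sel id ‖ f ‖ (map (λ A → ‖ f ∘ ⟦ A ⟧ ‖) (𝒜 n))
... | inj₁ e = identityMap n , identityMap-bijection n ,
               trans e (‖‖-cong (λ x → cong f (sym (identityMap-id x))))
... | inj₂ m with A , A∈𝒜 , e ← ∈-map⁻ (λ A → ‖ f ∘ ⟦ A ⟧ ‖) m =
  A , proj₂ (∈-filter⁻ isBijection? {xs = affineMaps n} A∈𝒜) , e

-- The inequality 2 ^ x ≤ t for the real number x = (p / q) · n^(1/6) ≥ 0, as 2 ^ r ≤ t for
-- every rational r = a / b with 0 ≤ r ≤ x.  Here a / b ≤ (p / q) · n^(1/6) is cleared of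
-- denominators and raised to the sixth power, and 2 ^ (a / b) ≤ t is raised to the power b.
2^[_/_·⁶√_]≤_ : (p q n t : ℕ) → Set
2^[ p / q ·⁶√ n ]≤ t =
  ∀ a b → NonZero b → (a * q) ^ 6 ≤ (p * b) ^ 6 * n → 2 ^ a ≤ t ^ b

{-# OPTIONS --safe #-}
-- Smolensky's method.  Let t = ‖ MAJ n ∘ A ‖.  Dropping the monomials of degree at least a
-- from the normal form changes MAJ n ∘ A on at most a fraction t / 2 ^ a of the points.  On the
-- other points every function is a polynomial of degree less than n/2 + a, so the changed points
-- are at least as many as the subsets of size at least n/2 + a.  For a = 42 j and j = n / 280
-- these are at least a fraction 2 ^ (j ∸ 1) / 2 ^ a of all subsets, whence t ≥ 2 ^ (j ∸ 1), which
-- is even exponential in n.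
module Submission where

open import Defs
open import Data.Bool.Base using (Bool; true; false; not; _∧_; _xor_; if_then_else_)
open import Data.Bool.Properties
  using (∧-identityʳ; ∧-zeroʳ; xor-comm; xor-identityʳ; not-involutive)
  renaming (_≟_ to _≟ᵇ_)
open import Data.Bool.Solver using (module xor-∧-Solver)
open import Data.Fin.Base using (Fin; combine; finToFun; funToFin)
open import Data.Fin.Properties using (2↔Bool; injective⇒≤; funToFin-finToFin; finToFun-funToFin)
open import Data.List.Base as List using (List; []; _∷_; filter; length)
open import Data.List.Properties using (length-++; filter-++; ++-identityʳ)
open import Data.Nat.Base
open import Data.Nat.DivMod using (m≡m%n+[m/n]*n; m%n<n; /-monoˡ-≤)
open import Data.Nat.Properties
open import Data.Nat.Solver using (module +-*-Solver)
open import Data.Product.Base using (∃-syntax; _×_; _,_; proj₁; proj₂)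
open import Data.Vec.Base as Vec using (Vec; []; _∷_; lookup; tabulate; take; drop)
open import Data.Vec.Properties
  using (++-injective; take++drop≡id; lookup∘tabulate; tabulate∘lookup; tabulate-cong)
open import Function.Base using (_∘_)
open import Function.Bundles using (Inverse)
open import Function.Definitions using (Injective)
open import Relation.Binary.PropositionalEquality
open import Relation.Nullary.Decidable using (dec-true; dec-false)
open import Relation.Nullary.Negation using (contradiction)

private variable
  k m n : ℕ

-- Splitting along the first variable, and counting points.

-- These are the two branches of `anf`: f = f₀ + x₁ ∂f. Hence `card (anf f)` unfolds to the sum of
-- the counts for `restrict f` and `∂ f`.
restrict ∂ : BooleanFunction (suc n) → BooleanFunction n
restrict f x = f (false ∷ x)
∂ f x = f (false ∷ x) xor f (true ∷ x)

-- Inverse to the splitting. With the x₁-term first, the value at `false ∷ x` reduces to `g x`.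
glue : BooleanFunction n → BooleanFunction n → BooleanFunction (suc n)
glue g h (x₁ ∷ x) = (x₁ ∧ h x) xor g x

card : BooleanFunction n → ℕ
card {zero}  p = if p [] then 1 else 0
card {suc n} p = card (restrict p) + card (p ∘ (true ∷_))

card-cong : {p q : BooleanFunction n} → p ≗ q → card p ≡ card q
card-cong {zero}  h = cong (if_then 1 else 0) (h [])
card-cong {suc n} h = cong₂ _+_ (card-cong (h ∘ (false ∷_))) (card-cong (h ∘ (true ∷_)))

card-xor : (p q : BooleanFunction n) → card (λ x → p x xor q x) ≤ card p + card q
card-xor {zero} p q with p [] | q []
... | true  | true  = z≤n
... | true  | false = ≤-refl
... | false | true  = ≤-refl
... | false | false = ≤-refl
card-xor {suc n} p q = begin
  card (λ x → restrict p x xor restrict q x) + card (λ x → p (true ∷ x) xor q (true ∷ x))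
    ≤⟨ +-mono-≤ (card-xor (restrict p) (restrict q)) (card-xor (p ∘ (true ∷_)) (q ∘ (true ∷_))) ⟩
  (p₀ + q₀) + (p₁ + q₁)
    ≡⟨ solve 4 (λ p₀ q₀ p₁ q₁ → (p₀ :+ q₀) :+ (p₁ :+ q₁) := (p₀ :+ p₁) :+ (q₀ :+ q₁)) refl p₀ q₀ p₁ q₁ ⟩
  (p₀ + p₁) + (q₀ + q₁) ∎
  where
  open ≤-Reasoning
  open +-*-Solver
  p₀ = card (restrict p)
  q₀ = card (restrict q)
  p₁ = card (p ∘ (true ∷_))
  q₁ = card (q ∘ (true ∷_))

card-not : (p : BooleanFunction n) → card p + card (not ∘ p) ≡ 2 ^ n
card-not {zero} p with p []
... | true  = refl
... | false = refl
card-not {suc n} p = begin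
  (p₀ + p₁) + (q₀ + q₁)
    ≡⟨ solve 4 (λ p₀ q₀ p₁ q₁ → (p₀ :+ p₁) :+ (q₀ :+ q₁) := (p₀ :+ q₀) :+ ((p₁ :+ q₁) :+ con 0)) refl p₀ q₀ p₁ q₁ ⟩
  (p₀ + q₀) + ((p₁ + q₁) + 0)
    ≡⟨ cong₂ (λ u v → u + (v + 0)) (card-not (restrict p)) (card-not (p ∘ (true ∷_))) ⟩
  2 ^ suc n ∎
  where
  open ≡-Reasoning
  open +-*-Solver
  p₀ = card (restrict p)
  p₁ = card (p ∘ (true ∷_))
  q₀ = card (not ∘ restrict p)
  q₁ = card (not ∘ p ∘ (true ∷_))

length-filter-map : {A B : Set} (g : A → B) (c : B → Bool) (xs : List A) →
  length (filter (λ y → c y ≟ᵇ true) (List.map g xs)) ≡ length (filter (λ x → c (g x) ≟ᵇ true) xs)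
length-filter-map g c []       = refl
length-filter-map g c (x ∷ xs) with c (g x)
... | true  = cong suc (length-filter-map g c xs)
... | false = length-filter-map g c xs

-- Replaces the list-based count by one that recurses together with `anf`.
sparsity≡card : (c : MultilinearPolynomial n) → sparsity c ≡ card c
sparsity≡card {zero} c with c []
... | true  = refl
... | false = refl
sparsity≡card {suc n} c = begin
  length (filter P? (List.map (false ∷_) ps List.++ (List.map (true ∷_) ps List.++ [])))
    ≡⟨ cong (λ l → length (filter P? (List.map (false ∷_) ps List.++ l))) (++-identityʳ _) ⟩
  length (filter P? (List.map (false ∷_) ps List.++ List.map (true ∷_) ps))
    ≡⟨ cong length (filter-++ P? (List.map (false ∷_) ps) _) ⟩
  length (filter P? (List.map (false ∷_) ps) List.++ filter P? (List.map (true ∷_) ps))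
    ≡⟨ length-++ (filter P? (List.map (false ∷_) ps)) ⟩
  length (filter P? (List.map (false ∷_) ps)) + length (filter P? (List.map (true ∷_) ps))
    ≡⟨ cong₂ _+_ (length-filter-map (false ∷_) c ps) (length-filter-map (true ∷_) c ps) ⟩
  sparsity (c ∘ (false ∷_)) + sparsity (c ∘ (true ∷_))
    ≡⟨ cong₂ _+_ (sparsity≡card (c ∘ (false ∷_))) (sparsity≡card (c ∘ (true ∷_))) ⟩
  card (c ∘ (false ∷_)) + card (c ∘ (true ∷_)) ∎
  where
  open ≡-Reasoning
  ps = points n
  P? = λ S → c S ≟ᵇ true

-- Truncation and its error.

-- The part of the algebraic normal form of f of degree less than k.
truncate : ℕ → BooleanFunction n → BooleanFunction n
truncate         zero    f x = false
truncate {zero}  (suc k) f   = f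
truncate {suc n} (suc k) f   = glue (truncate (suc k) (restrict f)) (truncate k (∂ f))

-- A monomial of degree at least k vanishes at every point of weight less than k.
truncate-agrees : (f : BooleanFunction n) (x : 𝔽₂^ n) → weight x < k → truncate k f x ≡ f x
truncate-agrees {zero}  {suc k} f x           _  = refl
truncate-agrees {suc n} {suc k} f (false ∷ x) lt = truncate-agrees (restrict f) x lt
truncate-agrees {suc n} {suc k} f (true ∷ x)  lt = trans
  (cong₂ _xor_ (truncate-agrees (∂ f) x (s<s⁻¹ lt)) (truncate-agrees (restrict f) x (m<n⇒m<1+n (s<s⁻¹ lt))))
  (trans (xor-comm (∂ f x) _) (xor-cancelˡ (restrict f x) _))

error : ℕ → BooleanFunction n → BooleanFunction n
error k f x = f x xor truncate k f x

-- On the half x₁ = 1, p is the sum of `restrict p` and `∂ p`.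
card-≤-∂ : (p : BooleanFunction (suc n)) → card p ≤ 2 * card (restrict p) + card (∂ p)
card-≤-∂ p = begin
  p₀ + card (p ∘ (true ∷_))
    ≡⟨ cong (p₀ +_) (card-cong (λ x → sym (xor-cancelˡ (restrict p x) (p (true ∷ x))))) ⟩
  p₀ + card (λ x → restrict p x xor ∂ p x)
    ≤⟨ +-monoʳ-≤ p₀ (card-xor (restrict p) (∂ p)) ⟩
  p₀ + (p₀ + card (∂ p))
    ≡⟨ solve 2 (λ u v → u :+ (u :+ v) := con 2 :* u :+ v) refl p₀ (card (∂ p)) ⟩
  2 * p₀ + card (∂ p) ∎
  where
  open ≤-Reasoning
  open +-*-Solver
  p₀ = card (restrict p)

∂-error : ∀ k (f : BooleanFunction (suc n)) → ∂ (error (suc k) f) ≗ error k (∂ f)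
∂-error k f x = solve 4 (λ u v s t → (u :+ s) :+ (v :+ (t :+ s)) := (u :+ v) :+ t) refl
  (f (false ∷ x)) (f (true ∷ x)) (truncate (suc k) (restrict f) x) (truncate k (∂ f) x)
  where open xor-∧-Solver

card-error : ∀ k (f : BooleanFunction n) → card (error k f) * 2 ^ k ≤ card (anf f) * 2 ^ n
card-error {zero} zero f with f []
... | true  = ≤-refl
... | false = ≤-refl
card-error {zero} (suc k) f with f []
... | true  = z≤n
... | false = z≤n
card-error {suc n} zero f = begin
  card (error 0 f) * 1
    ≤⟨ *-monoˡ-≤ 1 (card-≤-∂ (error 0 f)) ⟩
  (2 * card (error 0 (restrict f)) + card (∂ (error 0 f))) * 1
    ≡⟨ cong (λ u → (2 * card (error 0 (restrict f)) + u) * 1)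
         (card-cong (λ x → trans (cong₂ _xor_ (xor-identityʳ (f (false ∷ x))) (xor-identityʳ (f (true ∷ x))))
                                 (sym (xor-identityʳ _)))) ⟩
  (2 * A + B) * 1
    ≡⟨ solve 2 (λ a b → (con 2 :* a :+ b) :* con 1 := con 2 :* (a :* con 1) :+ b :* con 1) refl A B ⟩
  2 * (A * 1) + B * 1
    ≤⟨ +-mono-≤ (*-monoʳ-≤ 2 (card-error 0 (restrict f))) (card-error 0 (∂ f)) ⟩
  2 * (U * 2 ^ n) + V * 2 ^ n
    -- For k = 0 the derivative needs only half of its share of the bound.
    ≤⟨ +-monoʳ-≤ (2 * (U * 2 ^ n)) (m≤n*m (V * 2 ^ n) 2) ⟩
  2 * (U * 2 ^ n) + 2 * (V * 2 ^ n)
    ≡⟨ solve 3 (λ u v n → con 2 :* (u :* n) :+ con 2 :* (v :* n) := (u :+ v) :* (con 2 :* n)) refl U V (2 ^ n) ⟩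
  (U + V) * 2 ^ suc n ∎
  where
  open ≤-Reasoning
  open +-*-Solver
  A = card (error 0 (restrict f))
  B = card (error 0 (∂ f))
  U = card (anf (restrict f))
  V = card (anf (∂ f))
card-error {suc n} (suc k) f = begin
  card (error (suc k) f) * 2 ^ suc k
    ≤⟨ *-monoˡ-≤ (2 ^ suc k) (card-≤-∂ (error (suc k) f)) ⟩
  (2 * A + card (∂ (error (suc k) f))) * 2 ^ suc k
    ≡⟨ cong (λ u → (2 * A + u) * 2 ^ suc k) (card-cong (∂-error k f)) ⟩
  (2 * A + B) * 2 ^ suc k
    ≡⟨ solve 3 (λ a b k → (con 2 :* a :+ b) :* (con 2 :* k) := con 2 :* (a :* (con 2 :* k) :+ b :* k)) refl A B (2 ^ k) ⟩
  2 * (A * 2 ^ suc k + B * 2 ^ k)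
    -- `∂ f` is truncated one degree lower, so its hypothesis uses only `2 ^ k`; the factor 2 left
    -- over accounts for the extra variable.
    ≤⟨ *-monoʳ-≤ 2 (+-mono-≤ (card-error (suc k) (restrict f)) (card-error k (∂ f))) ⟩
  2 * (U * 2 ^ n + V * 2 ^ n)
    ≡⟨ solve 3 (λ u v n → con 2 :* (u :* n :+ v :* n) := (u :+ v) :* (con 2 :* n)) refl U V (2 ^ n) ⟩
  (U + V) * 2 ^ suc n ∎
  where
  open ≤-Reasoning
  open +-*-Solver
  A = card (error (suc k) (restrict f))
  B = card (error k (∂ f))
  U = card (anf (restrict f))
  V = card (anf (∂ f))

-- Polynomials of bounded degree.

-- The bound is strict, so that bound 0 means the zero polynomial. The recursion is that of `anf`,
-- with `∂ f` one degree lower.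
data Degree< : ℕ → BooleanFunction n → Set where
  vanishes : {f : BooleanFunction n} → (∀ x → f x ≡ false) → Degree< 0 f
  point    : {f : BooleanFunction 0} → Degree< (suc k) f
  split    : {f : BooleanFunction (suc n)} →
             Degree< (suc k) (restrict f) → Degree< k (∂ f) → Degree< (suc k) f

Degree<-cong : {f g : BooleanFunction n} → f ≗ g → Degree< k f → Degree< k g
Degree<-cong h (vanishes z) = vanishes λ x → trans (sym (h x)) (z x)
Degree<-cong h point        = point
Degree<-cong h (split d e)  = split (Degree<-cong (h ∘ (false ∷_)) d)
  (Degree<-cong (λ x → cong₂ _xor_ (h (false ∷ x)) (h (true ∷ x))) e)

Degree<-false : Degree< {n} k (λ _ → false)
Degree<-false         {k = zero}  = vanishes λ _ → refl
Degree<-false {zero}  {k = suc k} = point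
Degree<-false {suc n} {k = suc k} = split Degree<-false Degree<-false

Degree<-const : ∀ c → Degree< {n} (suc k) (λ _ → c)
Degree<-const {zero}  c     = point
Degree<-const {suc n} false = split (Degree<-const false) Degree<-false
Degree<-const {suc n} true  = split (Degree<-const true) Degree<-false

Degree<-suc : {f : BooleanFunction n} → Degree< k f → Degree< (suc k) f
Degree<-suc (vanishes z) = Degree<-cong (λ x → sym (z x)) Degree<-false
Degree<-suc point        = point
Degree<-suc (split d e)  = split (Degree<-suc d) (Degree<-suc e)

Degree<-+ : ∀ j .{{_ : NonZero j}} {f : BooleanFunction n} → Degree< (suc k) f → Degree< (j + k) f
Degree<-+ (suc zero)    d = d
Degree<-+ (suc (suc j)) d = Degree<-suc (Degree<-+ (suc j) d)

Degree<-xor : {f g : BooleanFunction n} → Degree< k f → Degree< k g → Degree< k (λ x → f x xor g x)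
Degree<-xor (vanishes z) (vanishes z′) = vanishes λ x → cong₂ _xor_ (z x) (z′ x)
Degree<-xor point        point         = point
Degree<-xor {f = f} {g} (split d e) (split d′ e′) = split (Degree<-xor d d′)
  (Degree<-cong (λ x → solve 4 (λ s t u v → (s :+ t) :+ (u :+ v) := (s :+ u) :+ (t :+ v)) refl
                         (f (false ∷ x)) (f (true ∷ x)) (g (false ∷ x)) (g (true ∷ x)))
                (Degree<-xor e e′))
  where open xor-∧-Solver

Degree<-true∷ : {f : BooleanFunction (suc n)} →
  Degree< (suc k) (restrict f) → Degree< k (∂ f) → Degree< (suc k) (f ∘ (true ∷_))
Degree<-true∷ {f = f} d e =
  Degree<-cong (λ x → xor-cancelˡ (f (false ∷ x)) (f (true ∷ x))) (Degree<-xor d (Degree<-suc e))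

-- Degrees add, and with strict bounds one unit is lost; writing the second bound as `suc b` avoids
-- a subtraction. The induction uses the product rule ∂(fg) = ∂f g₁ + f₀ ∂g.
Degree<-∧ : ∀ {a b} {f g : BooleanFunction n} → Degree< a f → Degree< (suc b) g →
            Degree< (a + b) (λ x → f x ∧ g x)
Degree<-∧ (vanishes z) _ = Degree<-cong (λ x → sym (cong (_∧ _) (z x))) Degree<-false
Degree<-∧ point point = point
Degree<-∧ {suc n} {suc a} {b} {f} {g} (split d e) (split d′ e′) = split (Degree<-∧ d d′)
  (Degree<-cong
    (λ x → solve 4 (λ s t u v → ((s :+ t) :* v) :+ (s :* (u :+ v)) := (s :* u) :+ (t :* v)) refl
             (f (false ∷ x)) (f (true ∷ x)) (g (false ∷ x)) (g (true ∷ x)))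
    (Degree<-xor (Degree<-∧ e (Degree<-true∷ {f = g} d′ e′)) (f₀∂g e′)))
  where
  open xor-∧-Solver
  -- The bound on `∂ g` may be 0, where the induction hypothesis does not apply but the product
  -- vanishes.
  f₀∂g : ∀ {b} → Degree< b (∂ g) → Degree< (a + b) (λ x → restrict f x ∧ ∂ g x)
  f₀∂g {zero}  (vanishes z) = Degree<-cong
    (λ x → sym (trans (cong (restrict f x ∧_) (z x)) (∧-zeroʳ (restrict f x)))) Degree<-false
  f₀∂g {suc b} e″ = subst (λ j → Degree< j (λ x → restrict f x ∧ ∂ g x)) (sym (+-suc a b)) (Degree<-∧ d e″)

Degree<-truncate : ∀ k (f : BooleanFunction n) → Degree< k (truncate k f)
Degree<-truncate         zero    f = vanishes λ _ → refl
Degree<-truncate {zero}  (suc k) f = point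
Degree<-truncate {suc n} (suc k) f = split (Degree<-truncate (suc k) (restrict f))
  (Degree<-cong (λ x → solve 2 (λ s t → t := s :+ (t :+ s)) refl (truncate (suc k) (restrict f) x) _)
                (Degree<-truncate k (∂ f)))
  where open xor-∧-Solver

Degree<-linear : (r : 𝔽₂^ n) → Degree< 2 (dot r)
Degree<-linear []       = point
Degree<-linear (r₁ ∷ r) = split
  (Degree<-cong (λ x → cong (_xor dot r x) (sym (∧-zeroʳ r₁))) (Degree<-linear r))
  (Degree<-cong (λ x → solve 2 (λ r₁ s → r₁ := (r₁ :* con false :+ s) :+ (r₁ :* con true :+ s)) refl r₁ (dot r x))
                (Degree<-const r₁))
  where open xor-∧-Solver

-- In f₀ + y₁ ∂f an affine form is substituted for y₁; `∂ f` has one degree less, which pays for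
-- that factor. The matrix is rectangular because the induction removes rows but keeps the number of
-- variables.
Degree<-∘-affine : {f : BooleanFunction m} (M : Vec (𝔽₂^ n) m) (c : 𝔽₂^ m) → Degree< k f →
  Degree< k (λ x → f (Vec.map (λ r → dot r x) M ⊕ c))
Degree<-∘-affine M c (vanishes z) = vanishes λ x → z _
Degree<-∘-affine {f = f} [] [] point = Degree<-const (f [])
Degree<-∘-affine {suc m} {n} {suc k} {f} (r ∷ M) (c₁ ∷ c) (split d e) =
  Degree<-cong (λ x → expand (λ b → f (b ∷ A x)) (dot r x xor c₁))
    (Degree<-xor (Degree<-∘-affine M c d)
      (subst (λ j → Degree< j (λ x → ∂ f (A x) ∧ (dot r x xor c₁))) (+-comm k 1)
        (Degree<-∧ (Degree<-∘-affine M c e) (Degree<-xor (Degree<-linear r) (Degree<-const c₁)))))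
  where
  A : 𝔽₂^ n → 𝔽₂^ m
  A x = Vec.map (λ r → dot r x) M ⊕ c

  expand : ∀ (g : Bool → Bool) b → g false xor ((g false xor g true) ∧ b) ≡ g b
  expand g true  = trans (cong (g false xor_) (∧-identityʳ _)) (xor-cancelˡ (g false) (g true))
  expand g false = trans (cong (g false xor_) (∧-zeroʳ (g false xor g true))) (xor-identityʳ (g false))

complement : 𝔽₂^ n → 𝔽₂^ n
complement = Vec.map not

complement-involutive : (x : 𝔽₂^ n) → complement (complement x) ≡ x
complement-involutive []       = refl
complement-involutive (x₁ ∷ x) = cong₂ _∷_ (not-involutive x₁) (complement-involutive x)

weight-complement : (x : 𝔽₂^ n) → weight x + weight (complement x) ≡ n
weight-complement []          = refl
weight-complement (true ∷ x)  = cong suc (weight-complement x)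
weight-complement (false ∷ x) = trans (+-suc (weight x) _) (cong suc (weight-complement x))

-- Flipping x₁ exchanges f₀ with f₀ + ∂f and fixes ∂f.
Degree<-complement : {f : BooleanFunction n} → Degree< k f → Degree< k (f ∘ complement)
Degree<-complement (vanishes z) = vanishes λ x → z (complement x)
Degree<-complement point        = point
Degree<-complement {f = f} (split d e) = split
  (Degree<-cong (λ x → xor-cancelˡ (f (false ∷ complement x)) (f (true ∷ complement x)))
    (Degree<-xor (Degree<-complement d) (Degree<-suc (Degree<-complement e))))
  (Degree<-cong (λ x → xor-comm (f (false ∷ complement x)) (f (true ∷ complement x)))
    (Degree<-complement e))

-- Tails of the binomial distribution.

-- lower n k and upper n k are the numbers of subsets of [n] of size less than k and at least k.
lower upper : ℕ → ℕ → ℕ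
lower n       zero    = 0
lower zero    (suc k) = 1
lower (suc n) (suc k) = lower n (suc k) + lower n k
upper n       zero    = 2 ^ n
upper zero    (suc k) = 0
upper (suc n) (suc k) = upper n (suc k) + upper n k

lower+upper : ∀ n k → lower n k + upper n k ≡ 2 ^ n
lower+upper n       zero    = refl
lower+upper zero    (suc k) = refl
lower+upper (suc n) (suc k) = begin
  (lower n (suc k) + lower n k) + (upper n (suc k) + upper n k)
    ≡⟨ solve 4 (λ a b c d → (a :+ b) :+ (c :+ d) := (a :+ c) :+ ((b :+ d) :+ con 0)) refl
         (lower n (suc k)) (lower n k) (upper n (suc k)) (upper n k) ⟩
  (lower n (suc k) + upper n (suc k)) + ((lower n k + upper n k) + 0)
    ≡⟨ cong₂ (λ u v → u + (v + 0)) (lower+upper n (suc k)) (lower+upper n k) ⟩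
  2 ^ suc n ∎
  where
  open ≡-Reasoning
  open +-*-Solver

upper-suc : ∀ n k → upper n (suc k) ≤ upper n k
upper-suc zero    k       = z≤n
upper-suc (suc n) zero    = +-mono-≤ (upper-suc n 0) (≤-reflexive (sym (+-identityʳ _)))
upper-suc (suc n) (suc k) = +-mono-≤ (upper-suc n (suc k)) (upper-suc n k)

upper-double : ∀ n k → 2 * upper n k ≤ upper (suc n) k
upper-double n zero    = ≤-refl
upper-double n (suc k) = +-monoʳ-≤ (upper n (suc k))
  (≤-trans (≤-reflexive (+-identityʳ _)) (upper-suc n k))

-- Unions of a large subset of [m] and a large subset of a disjoint copy of [n] are large and
-- distinct.
upper-* : ∀ m n j k → upper m j * upper n k ≤ upper (m + n) (j + k)
upper-* zero    n zero    k = ≤-reflexive (*-identityˡ _)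
upper-* zero    n (suc j) k = z≤n
upper-* (suc m) n zero    k = begin
  2 * 2 ^ m * upper n k   ≡⟨ *-assoc 2 (2 ^ m) _ ⟩
  2 * (2 ^ m * upper n k) ≤⟨ *-monoʳ-≤ 2 (upper-* m n 0 k) ⟩
  2 * upper (m + n) k     ≤⟨ upper-double (m + n) k ⟩
  upper (suc m + n) k     ∎
  where open ≤-Reasoning
upper-* (suc m) n (suc j) k = begin
  (upper m (suc j) + upper m j) * upper n k
    ≡⟨ *-distribʳ-+ (upper n k) (upper m (suc j)) (upper m j) ⟩
  upper m (suc j) * upper n k + upper m j * upper n k
    ≤⟨ +-mono-≤ (upper-* m n (suc j) k) (upper-* m n j k) ⟩
  upper (suc m + n) (suc j + k) ∎
  where open ≤-Reasoning

upper-^ : ∀ m k j → upper m k ^ j ≤ upper (j * m) (j * k)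
upper-^ m k zero    = ≤-refl
upper-^ m k (suc j) =
  ≤-trans (*-monoʳ-≤ (upper m k) (upper-^ m k j)) (upper-* m (j * m) k (j * k))

-- Complementation maps the sets of size less than k injectively to sets of size at least l.
upper-complementary : ∀ n k l → k + l ≤ suc n → 2 ^ n ≤ upper n k + upper n l
upper-complementary n       zero    l       _ = m≤m+n (2 ^ n) _
upper-complementary n       (suc k) zero    _ = m≤n+m (2 ^ n) _
upper-complementary zero    (suc k) (suc l) (s≤s h) = contradiction h (λ p → m+1+n≰m _ (≤-trans p z≤n))
upper-complementary (suc n) (suc k) (suc l) (s≤s h) = begin
  2 ^ n + (2 ^ n + 0)
    ≡⟨ cong (2 ^ n +_) (+-identityʳ _) ⟩
  2 ^ n + 2 ^ n
    ≤⟨ +-mono-≤ (upper-complementary n (suc k) l (≤-trans (≤-reflexive (sym (+-suc k l))) h))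
                (upper-complementary n k (suc l) h) ⟩
  (upper n (suc k) + upper n l) + (upper n k + upper n (suc l))
    ≡⟨ solve 4 (λ a b c d → (a :+ b) :+ (c :+ d) := (a :+ c) :+ (d :+ b)) refl
         (upper n (suc k)) (upper n l) (upper n k) (upper n (suc l)) ⟩
  upper (suc n) (suc k) + upper (suc n) (suc l) ∎
  where
  open ≤-Reasoning
  open +-*-Solver

-- Counting polynomials and interpolation.

-- Lists the coefficients of the monomials of degree less than k.
encode : ∀ k → BooleanFunction n → Vec Bool (lower n k)
encode         zero    f = []
encode {zero}  (suc k) f = f [] ∷ []
encode {suc n} (suc k) f = encode (suc k) (restrict f) Vec.++ encode k (∂ f)

encode-injective : {f g : BooleanFunction n} → Degree< k f → Degree< k g →
  encode k f ≡ encode k g → f ≗ g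
encode-injective (vanishes z) (vanishes z′) _ x = trans (z x) (sym (z′ x))
encode-injective point point e [] = cong Vec.head e
encode-injective {suc n} {suc k} {f} {g} (split d e) (split d′ e′) eq = λ
  { (false ∷ x) → f₀≗g₀ x
  ; (true ∷ x)  → trans (sym (xor-cancelˡ (f (false ∷ x)) (f (true ∷ x))))
                    (trans (cong₂ _xor_ (f₀≗g₀ x) (∂f≗∂g x)) (xor-cancelˡ (g (false ∷ x)) (g (true ∷ x)))) }
  where
  eqs   = ++-injective (encode (suc k) (restrict f)) (encode (suc k) (restrict g)) eq
  f₀≗g₀ = encode-injective d d′ (proj₁ eqs)
  ∂f≗∂g = encode-injective e e′ (proj₂ eqs)

-- The truth value is a separate argument, so that matching on it also fixes the length of the
-- vector.
headOrFalse : ∀ c → Vec Bool (if c then 1 else 0) → Bool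
headOrFalse true  v = Vec.head v
headOrFalse false v = false

headOrFalse-injective : ∀ c (v w : Vec Bool (if c then 1 else 0)) →
  (c ≡ true → headOrFalse c v ≡ headOrFalse c w) → v ≡ w
headOrFalse-injective true  (_ ∷ []) (_ ∷ []) h = cong (_∷ []) (h refl)
headOrFalse-injective false []       []       h = refl

-- The function that vanishes off p and whose values on p are listed by v.
spread : (p : BooleanFunction n) → Vec Bool (card p) → BooleanFunction n
spread {zero}  p v []          = headOrFalse (p []) v
spread {suc n} p v (false ∷ x) = spread (restrict p) (take (card (restrict p)) v) x
spread {suc n} p v (true ∷ x)  = spread (p ∘ (true ∷_)) (drop (card (restrict p)) v) x

spread-injective : (p : BooleanFunction n) (v w : Vec Bool (card p)) →
  (∀ x → p x ≡ true → spread p v x ≡ spread p w x) → v ≡ w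
spread-injective {zero}  p v w h = headOrFalse-injective (p []) v w (h [])
spread-injective {suc n} p v w h = begin
  v                    ≡⟨ take++drop≡id p₀ v ⟨
  take p₀ v Vec.++ drop p₀ v
    ≡⟨ cong₂ Vec._++_ (spread-injective (restrict p) (take p₀ v) (take p₀ w) (h ∘ (false ∷_)))
                      (spread-injective (p ∘ (true ∷_)) (drop p₀ v) (drop p₀ w) (h ∘ (true ∷_))) ⟩
  take p₀ w Vec.++ drop p₀ w ≡⟨ take++drop≡id p₀ w ⟩
  w ∎
  where
  open ≡-Reasoning
  p₀ = card (restrict p)

fromFin : ∀ m → Fin (2 ^ m) → Vec Bool m
fromFin m i = tabulate (Inverse.to 2↔Bool ∘ finToFun {2} {m} i)

toFin : Vec Bool m → Fin (2 ^ m)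
toFin v = funToFin (Inverse.from 2↔Bool ∘ lookup v)

funToFin-cong : {f g : Fin m → Fin n} → f ≗ g → funToFin f ≡ funToFin g
funToFin-cong {zero}  h = refl
funToFin-cong {suc m} h = cong₂ combine (h Fin.zero) (funToFin-cong (h ∘ Fin.suc))

toFin-fromFin : ∀ m (i : Fin (2 ^ m)) → toFin (fromFin m i) ≡ i
toFin-fromFin m i = trans
  (funToFin-cong λ j → trans (cong (Inverse.from 2↔Bool) (lookup∘tabulate (Inverse.to 2↔Bool ∘ finToFun {2} {m} i) j))
                                     (Inverse.strictlyInverseʳ 2↔Bool (finToFun {2} {m} i j)))
  (funToFin-finToFin {m} {2} i)

fromFin-toFin : (v : Vec Bool m) → fromFin m (toFin v) ≡ v
fromFin-toFin v = trans
  (tabulate-cong λ j → trans (cong (Inverse.to 2↔Bool) (finToFun-funToFin (Inverse.from 2↔Bool ∘ lookup v) j))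
                             (Inverse.strictlyInverseˡ 2↔Bool (lookup v j)))
  (tabulate∘lookup v)

-- The pigeonhole principle for 2 ^ m and 2 ^ n elements, carried over to `Fin`.
injective⇒length≤ : (g : Vec Bool m → Vec Bool n) → Injective _≡_ _≡_ g → m ≤ n
injective⇒length≤ {m} {n} g g-injective =
  ≮⇒≥ λ n<m → <⇒≱ (^-monoʳ-< 2 ≤-refl n<m)
    (injective⇒≤ {f = toFin ∘ g ∘ fromFin m} λ {i} {j} e →
      trans (sym (toFin-fromFin m i))
        (trans (cong toFin (g-injective (trans (sym (fromFin-toFin _)) (trans (cong (fromFin n) e) (fromFin-toFin _)))))
               (toFin-fromFin m j)))

-- The functions on the set p number 2 ^ card p, the polynomials of degree less than k number
-- 2 ^ lower n k.
interpolable⇒card≤lower : (p : BooleanFunction n) (Q : BooleanFunction n → BooleanFunction n) →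
  (∀ h → Degree< k (Q h)) → (∀ h x → p x ≡ true → Q h x ≡ h x) → card p ≤ lower n k
interpolable⇒card≤lower {k = k} p Q Q-degree Q-agrees =
  -- Prescribed values on p are sent to the coefficients of their interpolating polynomial, which
  -- takes those values back on p.
  injective⇒length≤ (λ v → encode k (Q (spread p v))) λ {v} {w} e →
    spread-injective p v w λ x px → trans (sym (Q-agrees (spread p v) x px))
      (trans (encode-injective (Q-degree (spread p v)) (Q-degree (spread p w)) e x)
             (Q-agrees (spread p w) x px))

-- Majority after an affine bijection.

-- A function of degree at most b can be prescribed on the points of weight at most b, and
-- likewise on those of weight at least n ∸ b; majority selects between the two.
module _ (A : AffineMap n) (A-bijective : IsBijection A) (a b : ℕ) .{{_ : NonZero a}}
         (n<2+2b : n < 2 * suc b) where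

  private
    f : BooleanFunction n
    f = MAJ n ∘ ⟦ A ⟧

    A⁻¹ : 𝔽₂^ n → 𝔽₂^ n
    A⁻¹ y = proj₁ (proj₂ A-bijective y)

    A⁻¹-A : ∀ x → A⁻¹ (⟦ A ⟧ x) ≡ x
    A⁻¹-A x = proj₁ A-bijective (proj₂ (proj₂ A-bijective (⟦ A ⟧ x)) refl)

    low high : BooleanFunction n → BooleanFunction n
    low  H = truncate (suc b) H
    high H = truncate (suc b) (H ∘ complement) ∘ complement

    low-agrees : ∀ H y → MAJ n y ≡ false → low H y ≡ H y
    low-agrees H y e = truncate-agrees H y (*-cancelˡ-< 2 (weight y) (suc b) (<-trans (≰⇒> n≰2w) n<2+2b))
      where
      n≰2w : n ≰ 2 * weight y
      n≰2w n≤2w = contradiction (trans (sym (dec-true (n ≤? 2 * weight y) n≤2w)) e) λ ()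

    high-agrees : ∀ H y → MAJ n y ≡ true → high H y ≡ H y
    high-agrees H y e = trans
      (truncate-agrees (H ∘ complement) (complement y) (*-cancelˡ-< 2 w′ (suc b) (≤-<-trans 2w′≤n n<2+2b)))
      (cong H (complement-involutive y))
      where
      open ≤-Reasoning
      w  = weight y
      w′ = weight (complement y)

      n≤2w : n ≤ 2 * w
      n≤2w = ≮⇒≥ λ 2w<n → contradiction (trans (sym e) (dec-false (n ≤? 2 * weight y) (<⇒≱ 2w<n))) λ ()

      2w′≤n : 2 * w′ ≤ n
      2w′≤n = +-cancelˡ-≤ n _ _ (begin
        n + 2 * w′     ≤⟨ +-monoˡ-≤ (2 * w′) n≤2w ⟩
        2 * w + 2 * w′ ≡⟨ *-distribˡ-+ 2 w w′ ⟨
        2 * (w + w′)   ≡⟨ cong (2 *_) (weight-complement y) ⟩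
        2 * n          ≡⟨ cong (n +_) (+-identityʳ n) ⟩
        n + n          ∎)

    P : BooleanFunction n
    P = truncate a f

    -- A polynomial form of: `high` where P is 1, `low` where P is 0. The target h is transported by
    -- `A⁻¹`, since majority speaks of the weight of `⟦ A ⟧ x`.
    Q : BooleanFunction n → BooleanFunction n
    Q h x = low H y xor (P x ∧ (low H y xor high H y))
      where
      H = h ∘ A⁻¹
      y = ⟦ A ⟧ x

    -- P has degree less than a, and `low` and `high` have degree at most b whatever h is, because
    -- they are truncations up to complement; composing with A does not raise degrees.
    Q-degree : ∀ h → Degree< (a + b) (Q h)
    Q-degree h = Degree<-xor
      (Degree<-+ a (Degree<-∘-affine (matrix A) (offset A) low-degree))
      (Degree<-∧ (Degree<-truncate a f)
        (Degree<-∘-affine (matrix A) (offset A)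
          (Degree<-xor low-degree (Degree<-complement (Degree<-truncate (suc b) (H ∘ complement))))))
      where
      H = h ∘ A⁻¹
      low-degree : Degree< (suc b) (low H)
      low-degree = Degree<-truncate (suc b) H

    selects : ∀ H y c → c ≡ MAJ n y → low H y xor (c ∧ (low H y xor high H y)) ≡ H y
    selects H y true  e = trans (xor-cancelˡ (low H y) (high H y)) (high-agrees H y (sym e))
    selects H y false e = trans (xor-identityʳ (low H y)) (low-agrees H y (sym e))

    Q-agrees : ∀ h x → not (error a f x) ≡ true → Q h x ≡ h x
    Q-agrees h x e = trans (selects (h ∘ A⁻¹) (⟦ A ⟧ x) (P x) (sym (no-error (f x) (P x) e)))
                           (cong h (A⁻¹-A x))
      where
      no-error : ∀ u v → not (u xor v) ≡ true → u ≡ v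
      no-error true  true  _ = refl
      no-error false false _ = refl

  -- Every h is interpolated off the error set by `Q h`, so at most `lower n (a + b)` points are
  -- free of error. The remaining ones are bounded by `card-error`.
  upper≤‖MAJ∘affine‖ : upper n (a + b) * 2 ^ a ≤ ‖ f ‖ * 2 ^ n
  upper≤‖MAJ∘affine‖ = begin
    upper n d * 2 ^ a     ≤⟨ *-monoˡ-≤ (2 ^ a) (+-cancelˡ-≤ (lower n d) _ _ upper≤error) ⟩
    card E * 2 ^ a        ≤⟨ card-error a f ⟩
    card (anf f) * 2 ^ n  ≡⟨ cong (_* 2 ^ n) (sparsity≡card (anf f)) ⟨
    ‖ f ‖ * 2 ^ n         ∎
    where
    open ≤-Reasoning
    d = a + b
    E = error a f
    upper≤error : lower n d + upper n d ≤ lower n d + card E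
    upper≤error = begin
      lower n d + upper n d    ≡⟨ lower+upper n d ⟩
      2 ^ n                    ≡⟨ card-not E ⟨
      card E + card (not ∘ E)  ≤⟨ +-monoʳ-≤ (card E) (interpolable⇒card≤lower (not ∘ E) Q Q-degree Q-agrees) ⟩
      card E + lower n d       ≡⟨ +-comm (card E) _ ⟩
      lower n d + card E       ∎

-- Numerical estimates for the tails.

-- The threshold 13 exceeds the mean 10 by 3, and upper 20 13 = 137980 > 2 ^ (20 ∸ 3); fourteen
-- such blocks exceed the mean by 42 on at least 2 ^ (280 ∸ 42 + 1) of the 2 ^ 280 points.
upper-blocks : ∀ j → 2 ^ (239 * j) ≤ upper (j * 280) (j * 182)
upper-blocks j = begin
  2 ^ (239 * j)                     ≡⟨ ^-*-assoc 2 239 j ⟨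
  (2 ^ 239) ^ j                     ≤⟨ ^-monoˡ-≤ j (≤ᵇ⇒≤ (2 ^ 239) (137980 ^ 14) _) ⟩
  (137980 ^ 14) ^ j                 ≡⟨ ^-*-assoc 137980 14 j ⟩
  -- `upper 20 13` evaluates to 137980.
  137980 ^ (14 * j)                 ≤⟨ upper-^ 20 13 (14 * j) ⟩
  upper (14 * j * 20) (14 * j * 13)
    ≡⟨ cong₂ upper (solve 1 (λ j → con 14 :* j :* con 20 := j :* con 280) refl j)
                   (solve 1 (λ j → con 14 :* j :* con 13 := j :* con 182) refl j) ⟩
  upper (j * 280) (j * 182)         ∎
  where
  open ≤-Reasoning
  open +-*-Solver

n<2+2⌊n/2⌋ : ∀ n → n < 2 * suc ⌊ n /2⌋
n<2+2⌊n/2⌋ n = begin-strict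
  n                         ≡⟨ ⌊n/2⌋+⌈n/2⌉≡n n ⟨
  ⌊ n /2⌋ + ⌈ n /2⌉         ≤⟨ +-monoʳ-≤ ⌊ n /2⌋ (⌊n/2⌋-mono (n≤1+n (suc n))) ⟩
  ⌊ n /2⌋ + suc ⌊ n /2⌋     <⟨ n<1+n _ ⟩
  suc ⌊ n /2⌋ + suc ⌊ n /2⌋ ≡⟨ cong (suc ⌊ n /2⌋ +_) (+-identityʳ _) ⟨
  2 * suc ⌊ n /2⌋           ∎
  where open ≤-Reasoning

-- For the r coordinates outside the blocks of 280: a threshold at the mean costs only a factor 2.
upper-half : ∀ r → 2 ^ r ≤ 2 * upper r ⌊ r /2⌋
upper-half r = ≤-trans (upper-complementary r ⌊ r /2⌋ ⌊ r /2⌋ 2⌊r/2⌋≤1+r)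
  (≤-reflexive (cong (upper r ⌊ r /2⌋ +_) (sym (+-identityʳ _))))
  where
  2⌊r/2⌋≤1+r : ⌊ r /2⌋ + ⌊ r /2⌋ ≤ suc r
  2⌊r/2⌋≤1+r = m≤n⇒m≤1+n (≤-trans (+-monoʳ-≤ ⌊ r /2⌋ (⌊n/2⌋≤⌈n/2⌉ r)) (≤-reflexive (⌊n/2⌋+⌈n/2⌉≡n r)))

-- The j blocks and the r remaining coordinates give a tail of at least 2 ^ (239 j + r) / 2 points;
-- the factor 2 ^ (42 j) raises this to 2 ^ (n + j) / 2, and 2 ^ n cancels.
2^j≤2*‖MAJ∘affine‖ : ∀ j .{{_ : NonZero j}} r → n ≡ r + j * 280 →
  (A : AffineMap n) → IsBijection A → 2 ^ j ≤ 2 * ‖ MAJ n ∘ ⟦ A ⟧ ‖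
2^j≤2*‖MAJ∘affine‖ {n} j r n≡ A A-bijective =
  *-cancelʳ-≤ (2 ^ j) (2 * t) (2 ^ n) {{m^n≢0 2 n}} (begin
    2 ^ j * 2 ^ n
      ≡⟨ ^-distribˡ-+-* 2 j n ⟨
    2 ^ (j + n)
      ≡⟨ cong (2 ^_) exponent ⟩
    2 ^ (239 * j + r + j * 42)
      ≡⟨ ^-distribˡ-+-* 2 (239 * j + r) (j * 42) ⟩
    2 ^ (239 * j + r) * 2 ^ (j * 42)
      ≡⟨ cong (_* 2 ^ (j * 42)) (^-distribˡ-+-* 2 (239 * j) r) ⟩
    2 ^ (239 * j) * 2 ^ r * 2 ^ (j * 42)
      ≤⟨ *-monoˡ-≤ (2 ^ (j * 42)) (*-mono-≤ (upper-blocks j) (upper-half r)) ⟩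
    U * (2 * R) * 2 ^ (j * 42)
      ≡⟨ solve 3 (λ u r e → u :* (con 2 :* r) :* e := con 2 :* (u :* r :* e)) refl U R (2 ^ (j * 42)) ⟩
    2 * (U * R * 2 ^ (j * 42))
      ≤⟨ *-monoʳ-≤ 2 (*-monoˡ-≤ (2 ^ (j * 42)) (upper-* (j * 280) r (j * 182) h)) ⟩
    2 * (upper (j * 280 + r) (j * 182 + h) * 2 ^ (j * 42))
      ≡⟨ cong₂ (λ m k → 2 * (upper m k * 2 ^ (j * 42))) (trans (+-comm (j * 280) r) (sym n≡)) threshold ⟩
    2 * (upper n (j * 42 + b) * 2 ^ (j * 42))
      ≤⟨ *-monoʳ-≤ 2 (upper≤‖MAJ∘affine‖ A A-bijective (j * 42) b {{m*n≢0 j 42}} n<2+2b) ⟩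
    2 * (t * 2 ^ n)
      ≡⟨ *-assoc 2 t (2 ^ n) ⟨
    2 * t * 2 ^ n ∎)
  where
  open ≤-Reasoning
  open +-*-Solver hiding (⟦_⟧)

  h b t U R : ℕ
  h = ⌊ r /2⌋
  -- This is half of n, rounded down, and with a = 42 j the threshold a + b is 182 j + h.
  b = j * 140 + h
  t = ‖ MAJ n ∘ ⟦ A ⟧ ‖
  U = upper (j * 280) (j * 182)
  R = upper r h

  exponent : j + n ≡ 239 * j + r + j * 42
  exponent = trans (cong (j +_) n≡)
    (solve 2 (λ j r → j :+ (r :+ j :* con 280) := con 239 :* j :+ r :+ j :* con 42) refl j r)

  threshold : j * 182 + h ≡ j * 42 + b
  threshold = solve 2 (λ j h → j :* con 182 :+ h := j :* con 42 :+ (j :* con 140 :+ h)) refl j h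

  n<2+2b : n < 2 * suc b
  n<2+2b = begin-strict
    n                        ≡⟨ n≡ ⟩
    r + j * 280              <⟨ +-monoˡ-< (j * 280) (n<2+2⌊n/2⌋ r) ⟩
    2 * suc h + j * 280
      ≡⟨ solve 2 (λ j h → con 2 :* (con 1 :+ h) :+ j :* con 280
                        := con 2 :* (con 1 :+ (j :* con 140 :+ h))) refl j h ⟩
    2 * suc b                ∎

-- From the exponential bound to the sixth root.

m≤m^1+k : ∀ m k .{{_ : NonZero m}} → m ≤ m ^ suc k
m≤m^1+k m k = m≤m*n m (m ^ k) {{m^n≢0 m k}}

-- With D = i + 1, n is at most 840 D and hence at most (840 D)^6, so n^(1/6) / 840 is at most D.
-- Every admissible a / b is then at most D.
2^[1/840·⁶√]≤ : ∀ i r t → r < 280 → 2 ^ suc i ≤ t → 2^[ 1 / 840 ·⁶√ r + suc (suc i) * 280 ]≤ t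
2^[1/840·⁶√]≤ i r t r<280 2^D≤t a b b≢0 h = begin
  2 ^ a         ≤⟨ ^-monoʳ-≤ 2 a≤Db ⟩
  2 ^ (D * b)   ≡⟨ ^-*-assoc 2 D b ⟨
  (2 ^ D) ^ b   ≤⟨ ^-monoˡ-≤ b 2^D≤t ⟩
  t ^ b         ∎
  where
  open ≤-Reasoning
  open +-*-Solver
  D = suc i

  n≤[840D]^6 : r + suc D * 280 ≤ (840 * D) ^ 6
  n≤[840D]^6 = begin
    r + suc D * 280       ≤⟨ +-monoˡ-≤ (suc D * 280) (<⇒≤ r<280) ⟩
    -- 840 is 3 times 280: the quotient i + 2 and the remainder together stay below 280 (i + 3),
    -- which is at most 840 (i + 1).
    280 + suc D * 280     ≤⟨ m≤m+n _ (i * 560) ⟩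
    280 + suc D * 280 + i * 560
      ≡⟨ solve 1 (λ i → con 280 :+ (con 2 :+ i) :* con 280 :+ i :* con 560
                      := con 840 :* (con 1 :+ i)) refl i ⟩
    840 * D               ≤⟨ m≤m^1+k (840 * D) 5 ⟩
    (840 * D) ^ 6         ∎

  ^6-cancel-≤ : ∀ {u v} → u ^ 6 ≤ v ^ 6 → u ≤ v
  ^6-cancel-≤ u^6≤v^6 = ≮⇒≥ λ v<u → <⇒≱ (^-monoˡ-< 6 v<u) u^6≤v^6

  a≤Db : a ≤ D * b
  a≤Db = *-cancelʳ-≤ a (D * b) 840 (^6-cancel-≤ (begin
    (a * 840) ^ 6                      ≤⟨ h ⟩
    (1 * b) ^ 6 * (r + suc D * 280)    ≤⟨ *-monoʳ-≤ ((1 * b) ^ 6) n≤[840D]^6 ⟩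
    (1 * b) ^ 6 * (840 * D) ^ 6
      ≡⟨ solve 2 (λ b d → (con 1 :* b) :^ 6 :* (con 840 :* d) :^ 6 := (d :* b :* con 840) :^ 6) refl b D ⟩
    (D * b * 840) ^ 6                  ∎))

proposition3 : ∃[ p ] ∃[ q ] (NonZero p × NonZero q ×
    (∃[ N ] (∀ (n : ℕ) → N ≤ n → 2^[ p / q ·⁶√ n ]≤ 𝒯 (MAJ n))))
-- 560 is twice 280, so the quotient j is at least 2 and the exponent j - 1 is positive.
proposition3 = 1 , 840 , _ , _ , 560 , bound
  where
  bound : ∀ n → 560 ≤ n → 2^[ 1 / 840 ·⁶√ n ]≤ 𝒯 (MAJ n)
  bound n 560≤n with n / 280 | /-monoˡ-≤ 280 560≤n | m≡m%n+[m/n]*n n 280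
  -- The quotients 0 and 1 are excluded by monotonicity of division.
  ... | suc (suc i) | s≤s (s≤s z≤n) | n≡ with A , A-bijective , 𝒯≡ ← 𝒯-attained (MAJ n) =
    subst (λ m → 2^[ 1 / 840 ·⁶√ m ]≤ 𝒯 (MAJ n)) (sym n≡)
      (2^[1/840·⁶√]≤ i (n % 280) (𝒯 (MAJ n)) (m%n<n n 280)
        (≤-trans (*-cancelˡ-≤ 2 (2^j≤2*‖MAJ∘affine‖ (suc (suc i)) (n % 280) n≡ A A-bijective))
                 (≤-reflexive (sym 𝒯≡))))
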